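{- Let $k\geq 3$, let $n=p^\alpha$ be a power of a prime $p$, let $q=p^\omega$ with $\omega\mid\alpha$, and let $H=\mathrm{Gal}(GF(n)/GF(q))$. Then the AST obtained from the action of $ASL_H(k,n)$ on $V=GF(n)^k$ is equal to the AST obtained from the action of $AGL_H(k,n)$ on $V$; that is, the two groups have the same orbits on $V\times V\times V$.
   Context: If a group $G$ acts two-transitively on a finite set $\Omega$ with at least 3 elements, the set of orbits of the induced diagonal action of $G$ on $\Omega\times\Omega\times\Omega$ is an association scheme on triples (AST), called the AST obtained from (the action of) $G$; it is this partition of $\Omega\times\Omega\times\Omega$ into orbits. $GF(n)$ is the field with $n$ elements, $V=GF(n)^k$, and $H$ acts on $V$ coordinatewise. $ASL_H(k,n)=ASL(k,n)\rtimes H$ is the group of maps $V\to V$ of the form $x\mapsto A\phi(x)+b$ with $A\in SL(k,n)$, $b\in V$, $\phi\in H$. $AGL_H(k,n)=AGL(k,n)\rtimes H$ is the group of maps $V\to V$ of the form $x\mapsto A\phi(x)+b$ with $A\in GL(k,n)$, $b\in V$, $\phi\in H$. Both act two-transitively on $V$. -}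

module Defs where

open import Algebra.Bundles using (CommutativeRing)
import Algebra.Definitions as AlgDefs
open import Algebra.Morphism.Structures using (module RingMorphisms)
import Algebra.Properties.Semiring.Exp as Exp
import Algebra.Properties.Semiring.Sum as Sum
open import Data.Bool.Base using (if_then_else_)
open import Data.Fin.Base using (Fin; zero; suc; toℕ)
open import Data.Fin.Properties using (_≟_)
open import Data.Nat.Base using (ℕ; zero; suc)
open import Data.Product.Base using (_×_; _,_; ∃-syntax)
open import Data.Vec.Functional using (Vector; zipWith; removeAt)
import Data.Vec.Functional.Relation.Binary.Equality.Setoid as VecEq
open import Function.Base using (_∘_)
open import Function.Bundles using (Inverse)
open import Level using (Level; _⊔_) renaming (suc to lsuc)
open import Relation.Binary.Bundles using (Setoid)
import Relation.Binary.PropositionalEquality as ≡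
open import Relation.Nullary using (¬_)
open import Relation.Nullary.Decidable using (does)
open import Relation.Unary using (Pred; _∈_; _≐_)

private
  variable
    c ℓ c′ ℓ′ g h : Level

-- A model of GF(n).
record FiniteField (c ℓ : Level) (n : ℕ) : Set (lsuc (c ⊔ ℓ)) where
  field
    commutativeRing : CommutativeRing c ℓ
  open CommutativeRing commutativeRing public
  open AlgDefs _≈_ using (Invertible)
  field
    1≉0         : ¬ 1# ≈ 0#
    invertible  : ∀ x → ¬ x ≈ 0# → Invertible 1# _*_ x
    enumeration : Inverse (≡.setoid (Fin n)) setoid

module _ {n q : ℕ} (F : FiniteField c ℓ n) (K : FiniteField c′ ℓ′ q) where
  private
    module F = FiniteField F
    module K = FiniteField K

  -- K is regarded as a subfield of F through such a map.
  IsEmbedding : (K.Carrier → F.Carrier) → Set (c′ ⊔ ℓ′ ⊔ ℓ)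
  IsEmbedding = RingMorphisms.IsRingMonomorphism K.rawRing F.rawRing

  Gal : (K.Carrier → F.Carrier) → Pred (F.Carrier → F.Carrier) (c ⊔ ℓ ⊔ c′)
  Gal ι φ = RingMorphisms.IsRingIsomorphism F.rawRing F.rawRing φ
          × (∀ x → φ (ι x) F.≈ ι x)

module Matrices {c ℓ n} (F : FiniteField c ℓ n) where
  open FiniteField F hiding (zero)
  open Exp semiring using (_^_)
  open Sum semiring using (sum)

  V : ℕ → Set c
  V k = Vector Carrier k

  V-setoid : ℕ → Setoid c ℓ
  V-setoid = VecEq.≋-setoid setoid

  -- M i j is the entry in row i and column j.
  Matrix : ℕ → Set c
  Matrix k = Vector (V k) k

  infix 4 _≈ᴹ_
  _≈ᴹ_ : ∀ {k} → Matrix k → Matrix k → Set ℓ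
  A ≈ᴹ B = ∀ i j → A i j ≈ B i j

  1ᴹ : ∀ {k} → Matrix k
  1ᴹ i j = if does (i ≟ j) then 1# else 0#

  infixl 7 _*ᴹ_ _*ⱽ_
  _*ᴹ_ : ∀ {k} → Matrix k → Matrix k → Matrix k
  (A *ᴹ B) i j = sum λ l → A i l * B l j

  _*ⱽ_ : ∀ {k} → Matrix k → V k → V k
  (A *ⱽ x) i = sum λ j → A i j * x j

  infixl 6 _+ⱽ_
  _+ⱽ_ : ∀ {k} → V k → V k → V k
  _+ⱽ_ = zipWith _+_

  -- Laplace expansion along the first row.
  det : ∀ {k} → Matrix k → Carrier
  det {zero}  A = 1#
  det {suc k} A = sum λ j →
    (- 1#) ^ toℕ j * (A zero j * det λ i → removeAt (A (suc i)) j)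

  GL : ∀ k → Pred (Matrix k) (c ⊔ ℓ)
  GL k = AlgDefs.Invertible _≈ᴹ_ 1ᴹ _*ᴹ_

  SL : ∀ k → Pred (Matrix k) (c ⊔ ℓ)
  SL k A = A ∈ GL k × det A ≈ 1#

  -- The maps x ↦ A φ(x) + b with A ∈ L, φ ∈ H and b ∈ V, where φ acts
  -- coordinatewise.
  AffineMaps : ∀ {k} → Pred (Matrix k) g → Pred (Carrier → Carrier) h →
               Pred (V k → V k) (c ⊔ ℓ ⊔ g ⊔ h)
  AffineMaps {k = k} L H f =
    ∃[ A ] ∃[ φ ] ∃[ b ]
      A ∈ L × φ ∈ H × (∀ x → f x V.≈ A *ⱽ (φ ∘ x) +ⱽ b)
    where module V = Setoid (V-setoid k)

  AGL : ∀ k → Pred (Carrier → Carrier) h → Pred (V k → V k) (c ⊔ ℓ ⊔ h)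
  AGL k H = AffineMaps (GL k) H

  ASL : ∀ k → Pred (Carrier → Carrier) h → Pred (V k → V k) (c ⊔ ℓ ⊔ h)
  ASL k H = AffineMaps (SL k) H

-- The set of orbits on Ω × Ω × Ω of a group G of permutations of Ω, the group
-- being given as a set of maps.  Subsets are predicates, and two of them are
-- the same when they have the same elements (_≐_).
module Triples (Ω : Setoid c ℓ) where
  open Setoid Ω

  Triple : Set c
  Triple = Carrier × Carrier × Carrier

  orbit : Pred (Carrier → Carrier) g → Triple → Pred Triple (c ⊔ ℓ ⊔ g)
  orbit G (x , y , z) (x′ , y′ , z′) =
    ∃[ f ] f ∈ G × f x ≈ x′ × f y ≈ y′ × f z ≈ z′

  AST : Pred (Carrier → Carrier) g → Pred (Pred Triple (c ⊔ ℓ ⊔ g)) (c ⊔ ℓ ⊔ g)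
  AST G R = ∃[ t ] R ≐ orbit G t

{-# OPTIONS --safe #-}
-- Any three points can be translated so that one of them is the origin, so for
-- A ∈ GL(k,n) one needs B ∈ SL(k,n) agreeing with A on two given vectors u and
-- v.  As k ≥ 3, some hyperplane l ∙ x = 0 contains u and v; let B = AD where D
-- is a dilation fixing this hyperplane, with determinant (det A)⁻¹.

module Submission where

open import Defs
import Algebra.Properties.Ring as RingProperties
import Algebra.Properties.Semiring.Exp as Exp
import Algebra.Properties.Semiring.Sum as Sum
import Algebra.Solver.Ring.NaturalCoefficients.Default as NaturalCoefficients
open import Data.Fin.Base as Fin using (Fin; zero; suc; inject₁; punchIn; punchOut; toℕ)
open import Data.Fin.Induction using (<-weakInduction)
open import Data.Fin.Properties
  using (any?; 0≢1+n; ≤-refl; _≟_; punchIn-punchOut; punchInᵢ≢i; suc-injective; toℕ-inject₁)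
open import Data.Nat.Base using (ℕ; zero; suc; z≤n; s≤s; _≤_; _<_; _^_)
open import Data.Nat.Divisibility using (_∣_)
open import Data.Nat.Primality using (Prime)
open import Data.Product.Base using (_×_; _,_; ∃-syntax)
open import Data.Vec.Functional using (Vector; _∷_; []; tail; updateAt; insertAt; removeAt)
open import Data.Vec.Functional.Properties
  using (updateAt-updates; updateAt-minimal; updateAt-commutes; map-updateAt;
         insertAt-lookup; insertAt-punchIn; removeAt-punchOut)
open import Function.Base using (_∘_; const; _$_; case_of_)
open import Function.Bundles using (Inverse)
open import Level using (Level; _⊔_)
open import Relation.Binary.Bundles using (Setoid)
open import Relation.Binary.PropositionalEquality as ≡ using (_≡_; _≢_; _≗_)
import Relation.Binary.Reasoning.Setoid as SetoidReasoning
open import Relation.Nullary using (¬_; Dec; yes; no; contradiction)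
open import Relation.Nullary.Decidable using (map′; ¬?; decidable-stable)
open import Relation.Unary using (Pred; _∈_; _≐_)
open import Relation.Unary.Properties using (≐-sym; ≐-trans)

-- Most of the work goes into the determinant of `A *ᴹ D`. `det` is given as a Laplace expansion
-- along the first row, which shows neither that it is multiplicative nor what it is on a dilation.
-- Both facts are obtained by regarding it as a function of the rows: `det` is an alternating
-- multilinear form, and every such form `D` on square matrices satisfies `D M ≈ det M * D 1ᴹ`. For
-- a fixed `B`, the form sending `M` to `det (M *ᴹ B)` must therefore be `det M * det B`. The scalar
-- (det A)⁻¹ is taken to be the determinant of the inverse matrix that comes with membership in
-- `GL k`; multiplicativity makes the two determinants inverse to each other.

module LinearAlgebra {c ℓ n} (F : FiniteField c ℓ n) where
  open FiniteField F hiding (zero)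
  open Matrices F
  open Exp semiring using () renaming (_^_ to _^ᶜ_)
  open Sum semiring
  open RingProperties ring
  open NaturalCoefficients commutativeSemiring using (solve; con; _:+_; _:*_; _:=_)
  open SetoidReasoning setoid

  -- Row replacement, vectors and sums

  infixl 10 _[_]≔_
  _[_]≔_ : ∀ {a} {A : Set a} {m} → Vector A m → Fin m → A → Vector A m
  M [ i ]≔ x = updateAt M i (const x)

  infix 4 _≈ⱽ_
  _≈ⱽ_ : ∀ {k} → V k → V k → Set ℓ
  x ≈ⱽ y = ∀ j → x j ≈ y j

  infix 4 _≈ᴿ_
  _≈ᴿ_ : ∀ {m k} → Vector (V k) m → Vector (V k) m → Set ℓ
  M ≈ᴿ N = ∀ i → M i ≈ⱽ N i

  infixl 7 _·_
  _·_ : ∀ {k} → Carrier → V k → V k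
  (a · x) j = a * x j

  0ⱽ : ∀ {k} → V k
  0ⱽ j = 0#

  []≔-cong : ∀ {m k} {M N : Vector (V k) m} i {x y} → M ≈ᴿ N → x ≈ⱽ y → M [ i ]≔ x ≈ᴿ N [ i ]≔ y
  []≔-cong zero    M≈N x≈y zero    = x≈y
  []≔-cong zero    M≈N x≈y (suc j) = M≈N (suc j)
  []≔-cong (suc i) M≈N x≈y zero    = M≈N zero
  []≔-cong (suc i) M≈N x≈y (suc j) = []≔-cong i (M≈N ∘ suc) x≈y j

  []≔-self : ∀ {m k} (M : Vector (V k) m) i {x} → x ≈ⱽ M i → M [ i ]≔ x ≈ᴿ M
  []≔-self M zero    x≈ zero    = x≈
  []≔-self M zero    x≈ (suc j) = λ _ → refl
  []≔-self M (suc i) x≈ zero    = λ _ → refl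
  []≔-self M (suc i) x≈ (suc j) = []≔-self (tail M) i x≈ j

  ≡⇒≈ⱽ : ∀ {k} {x y : V k} → x ≡ y → x ≈ⱽ y
  ≡⇒≈ⱽ ≡.refl j = refl

  linear-scale : ∀ s a x y → s * (a * x + y) ≈ a * (s * x) + s * y
  linear-scale = solve 4 (λ s a x y → s :* (a :* x :+ y) := a :* (s :* x) :+ s :* y) refl

  det-row-linear : ∀ s d a x y → s * ((a * x + y) * d) ≈ a * (s * (x * d)) + s * (y * d)
  det-row-linear = solve 5
    (λ s d a x y → s :* ((a :* x :+ y) :* d) := a :* (s :* (x :* d)) :+ s :* (y :* d)) refl

  push-in : ∀ s a t b m → (s * a) * (t * (b * m)) ≈ (s * t) * ((a * b) * m)
  push-in = solve 5 (λ s a t b m → (s :* a) :* (t :* (b :* m)) := (s :* t) :* ((a :* b) :* m)) refl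

  -- The solver treats commutative semirings, so - 1 enters as a variable `ε`.
  pull-sign : ∀ ε s t a b m → ((ε * t) * s) * ((a * b) * m) ≈ ε * ((s * t) * ((b * a) * m))
  pull-sign = solve 6
    (λ ε s t a b m → ((ε :* t) :* s) :* ((a :* b) :* m) := ε :* ((s :* t) :* ((b :* a) :* m))) refl

  collect : ∀ a d s D → a * (d * (s * D)) ≈ (s * (a * d)) * D
  collect = solve 4 (λ a d s D → a :* (d :* (s :* D)) := (s :* (a :* d)) :* D) refl

  sum-zero : ∀ {r} (f : Vector Carrier r) → (∀ i → f i ≈ 0#) → sum f ≈ 0#
  sum-zero {r} f f≈0 = trans (sum-cong-≋ f≈0) (sum-replicate-zero r)

  sum-single : ∀ {r} (i : Fin r) (f : Vector Carrier r) → (∀ j → j ≢ i → f j ≈ 0#) → sum f ≈ f i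
  sum-single {suc r} i f f≈0 = begin
    sum f                        ≈⟨ sum-remove {i = i} f ⟩
    f i + sum (removeAt f i)     ≈⟨ +-congˡ (sum-zero _ (λ j → f≈0 _ (punchInᵢ≢i i j))) ⟩
    f i + 0#                     ≈⟨ +-identityʳ _ ⟩
    f i                          ∎

  -- Alternating multilinear forms

  record IsLinear {k l} (⟦_⟧ : V k → V l) : Set (c ⊔ ℓ) where
    field
      cong   : ∀ {x y} → x ≈ⱽ y → ⟦ x ⟧ ≈ⱽ ⟦ y ⟧
      linear : ∀ a x y → ⟦ a · x +ⱽ y ⟧ ≈ⱽ a · ⟦ x ⟧ +ⱽ ⟦ y ⟧

  -- Alternation is vanishing on repeated rows, since antisymmetry would be too weak in
  -- characteristic 2. The number `m` of rows and their length `k` are independent because fixing a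
  -- row or altering the columns changes only one of them.
  record IsAltForm {m k} (⟦_⟧ : Vector (V k) m → Carrier) : Set (c ⊔ ℓ) where
    field
      cong        : ∀ {M N} → M ≈ᴿ N → ⟦ M ⟧ ≈ ⟦ N ⟧
      linear      : ∀ M i a x y →
                    ⟦ M [ i ]≔ (a · x +ⱽ y) ⟧ ≈ a * ⟦ M [ i ]≔ x ⟧ + ⟦ M [ i ]≔ y ⟧
      alternating : ∀ M i j → i ≢ j → M i ≈ⱽ M j → ⟦ M ⟧ ≈ 0#

    linear-0 : ∀ M i → ⟦ M [ i ]≔ 0ⱽ ⟧ ≈ 0#
    linear-0 M i = x+x≈x⇒x≈0 z (begin
      z + z                           ≈⟨ +-congʳ (*-identityˡ z) ⟨
      1# * z + z                      ≈⟨ linear M i 1# 0ⱽ 0ⱽ ⟨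
      ⟦ M [ i ]≔ (1# · 0ⱽ +ⱽ 0ⱽ) ⟧
        ≈⟨ cong ([]≔-cong i (λ _ _ → refl) (λ _ → trans (+-identityʳ _) (zeroʳ 1#))) ⟩
      z                               ∎)
      where z = ⟦ M [ i ]≔ 0ⱽ ⟧

    linear-sum : ∀ M i {r} (a : Vector Carrier r) (x : Vector (V k) r) →
                 ⟦ M [ i ]≔ (λ j → ∑[ l < r ] (a l * x l j)) ⟧ ≈ ∑[ l < r ] (a l * ⟦ M [ i ]≔ x l ⟧)
    linear-sum M i {zero}  a x = linear-0 M i
    linear-sum M i {suc r} a x =
      trans (linear M i (a zero) (x zero) _) (+-congˡ (linear-sum M i (tail a) (tail x)))

    linear-+ : ∀ M i x y → ⟦ M [ i ]≔ (x +ⱽ y) ⟧ ≈ ⟦ M [ i ]≔ x ⟧ + ⟦ M [ i ]≔ y ⟧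
    linear-+ M i x y = begin
      ⟦ M [ i ]≔ (x +ⱽ y) ⟧
        ≈⟨ cong ([]≔-cong i (λ _ _ → refl) (λ _ → +-congʳ (sym (*-identityˡ _)))) ⟩
      ⟦ M [ i ]≔ (1# · x +ⱽ y) ⟧                 ≈⟨ linear M i 1# x y ⟩
      1# * ⟦ M [ i ]≔ x ⟧ + ⟦ M [ i ]≔ y ⟧       ≈⟨ +-congʳ (*-identityˡ _) ⟩
      ⟦ M [ i ]≔ x ⟧ + ⟦ M [ i ]≔ y ⟧            ∎

    private
      equal-rows : ∀ M i j → i ≢ j → ∀ x → ⟦ M [ i ]≔ x [ j ]≔ x ⟧ ≈ 0#
      equal-rows M i j i≢j x = alternating _ i j i≢j (≡⇒≈ⱽ (≡.trans
        (≡.trans (updateAt-minimal i j (M [ i ]≔ x) i≢j) (updateAt-updates i M))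
        (≡.sym (updateAt-updates j (M [ i ]≔ x)))))

      []≔-comm : ∀ (M : Vector (V k) m) i j → i ≢ j → ∀ x y → M [ i ]≔ x [ j ]≔ y ≈ᴿ M [ j ]≔ y [ i ]≔ x
      []≔-comm M i j i≢j x y l = ≡⇒≈ⱽ (updateAt-commutes j i (i≢j ∘ ≡.sym) M l)

    -- The cross terms of the form evaluated with x + y in both rows.
    swap : ∀ M i j → i ≢ j → ∀ x y →
           ⟦ M [ i ]≔ x [ j ]≔ y ⟧ + ⟦ M [ i ]≔ y [ j ]≔ x ⟧ ≈ 0#
    swap M i j i≢j x y = begin
      ⟦xy⟧ + ⟦yx⟧
        ≈⟨ +-cong (+-identityˡ ⟦xy⟧) (+-identityʳ ⟦yx⟧) ⟨
      (0# + ⟦xy⟧) + (⟦yx⟧ + 0#)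
        ≈⟨ +-cong (+-congʳ (equal-rows M i j i≢j x)) (+-congˡ (equal-rows M i j i≢j y)) ⟨
      (⟦ M [ i ]≔ x [ j ]≔ x ⟧ + ⟦xy⟧) + (⟦yx⟧ + ⟦ M [ i ]≔ y [ j ]≔ y ⟧)
        ≈⟨ +-cong (linear-+ (M [ i ]≔ x) j x y) (linear-+ (M [ i ]≔ y) j x y) ⟨
      ⟦ M [ i ]≔ x [ j ]≔ s ⟧ + ⟦ M [ i ]≔ y [ j ]≔ s ⟧
        ≈⟨ +-cong (cong ([]≔-comm M i j i≢j x s)) (cong ([]≔-comm M i j i≢j y s)) ⟩
      ⟦ M [ j ]≔ s [ i ]≔ x ⟧ + ⟦ M [ j ]≔ s [ i ]≔ y ⟧    ≈⟨ linear-+ (M [ j ]≔ s) i x y ⟨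
      ⟦ M [ j ]≔ s [ i ]≔ s ⟧                              ≈⟨ equal-rows M j i (i≢j ∘ ≡.sym) s ⟩
      0#                                                  ∎
      where
        s    = x +ⱽ y
        ⟦xy⟧ = ⟦ M [ i ]≔ x [ j ]≔ y ⟧
        ⟦yx⟧ = ⟦ M [ i ]≔ y [ j ]≔ x ⟧

    -- After expansion in row `i`, the term of `M l` with `l ≢ i` has the row `M l` twice and
    -- vanishes.
    row-combination : ∀ M i (a : Vector Carrier m) →
                      ⟦ M [ i ]≔ (λ j → ∑[ l < m ] (a l * M l j)) ⟧ ≈ a i * ⟦ M ⟧
    row-combination M i a = begin
      ⟦ M [ i ]≔ (λ j → ∑[ l < m ] (a l * M l j)) ⟧   ≈⟨ linear-sum M i a M ⟩
      ∑[ l < m ] (a l * ⟦ M [ i ]≔ M l ⟧)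
        ≈⟨ sum-single i _ (λ l l≢i → trans (*-congˡ (repeated l l≢i)) (zeroʳ _)) ⟩
      a i * ⟦ M [ i ]≔ M i ⟧
        ≈⟨ *-congˡ (cong ([]≔-self M i (λ _ → refl))) ⟩
      a i * ⟦ M ⟧                                     ∎
      where
      repeated : ∀ l → l ≢ i → ⟦ M [ i ]≔ M l ⟧ ≈ 0#
      repeated l l≢i = alternating _ l i l≢i (≡⇒≈ⱽ (≡.trans
        (updateAt-minimal l i M l≢i) (≡.sym (updateAt-updates i M))))

  scale-isAltForm : ∀ {m k} s {D : Vector (V k) m → Carrier} → IsAltForm D → IsAltForm (λ M → s * D M)
  scale-isAltForm s D-alt = record
    { cong        = λ M≈N → *-congˡ (cong M≈N)
    ; linear      = λ M i a x y → trans (*-congˡ (linear M i a x y)) (linear-scale s a _ _)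
    ; alternating = λ M i j i≢j Mᵢ≈Mⱼ → trans (*-congˡ (alternating M i j i≢j Mᵢ≈Mⱼ)) (zeroʳ s)
    }
    where open IsAltForm D-alt

  sum-linear : ∀ r a (f g h : Vector Carrier r) → (∀ l → f l ≈ a * g l + h l) →
               sum f ≈ a * sum g + sum h
  sum-linear r a f g h f≈ = begin
    sum f                                       ≈⟨ sum-cong-≋ f≈ ⟩
    ∑[ l < r ] (a * g l + h l)                  ≈⟨ ∑-distrib-+ (λ l → a * g l) h ⟩
    ∑[ l < r ] (a * g l) + sum h                ≈⟨ +-congʳ (*-distribˡ-sum a g) ⟨
    a * sum g + sum h                           ∎

  sum-isAltForm : ∀ {m k} r {D : Fin r → Vector (V k) m → Carrier} →
                  (∀ l → IsAltForm (D l)) → IsAltForm (λ M → ∑[ l < r ] D l M)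
  sum-isAltForm r D-alt = record
    { cong        = λ M≈N → sum-cong-≋ (λ l → cong (D-alt l) M≈N)
    ; linear      = λ M i a x y → sum-linear r a _ _ _ (λ l → linear (D-alt l) M i a x y)
    ; alternating = λ M i j i≢j Mᵢ≈Mⱼ → sum-zero _ (λ l → alternating (D-alt l) M i j i≢j Mᵢ≈Mⱼ)
    }
    where open IsAltForm

  -- Applied to three maps of rows: removal of an entry (Laplace expansion), insertion of a zero
  -- (uniqueness of the determinant), and multiplication by a matrix on the right
  -- (multiplicativity).
  pullback-isAltForm : ∀ {m k l} {f : V k → V l} {D : Vector (V l) m → Carrier} →
                       IsLinear f → IsAltForm D → IsAltForm (λ M → D (λ i → f (M i)))
  pullback-isAltForm {m} {k} {l} {f} {D} f-lin D-alt = record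
    { cong        = λ M≈N → cong (λ i → f.cong (M≈N i))
    ; linear      = λ M i a x y → begin
        D (f ∘ M [ i ]≔ (a · x +ⱽ y))
          ≈⟨ cong (commute M i _ (f.linear a x y)) ⟩
        D ((f ∘ M) [ i ]≔ (a · f x +ⱽ f y))                ≈⟨ linear (f ∘ M) i a (f x) (f y) ⟩
        a * D ((f ∘ M) [ i ]≔ f x) + D ((f ∘ M) [ i ]≔ f y)
          ≈⟨ +-cong (*-congˡ (cong (commute M i x (λ _ → refl)))) (cong (commute M i y (λ _ → refl))) ⟨
        a * D (f ∘ M [ i ]≔ x) + D (f ∘ M [ i ]≔ y)        ∎
    ; alternating = λ M i j i≢j Mᵢ≈Mⱼ → alternating _ i j i≢j (f.cong Mᵢ≈Mⱼ)
    }
    where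
    open IsAltForm D-alt
    module f = IsLinear f-lin

    commute : ∀ (M : Vector (V k) m) i x {y} → f x ≈ⱽ y → f ∘ M [ i ]≔ x ≈ᴿ (f ∘ M) [ i ]≔ y
    commute M i x fx≈y j t = trans
      (≡⇒≈ⱽ (map-updateAt {f = f} {g = const x} {h = const (f x)} (λ _ → ≡.refl) M i j) t)
      ([]≔-cong i (λ _ _ → refl) fx≈y j t)

  ∷-[]≔ : ∀ {m k} (r : V k) (M : Vector (V k) m) i x → r ∷ (M [ i ]≔ x) ≈ᴿ (r ∷ M) [ suc i ]≔ x
  ∷-[]≔ r M i x zero    _ = refl
  ∷-[]≔ r M i x (suc j) _ = refl

  ∷-cong : ∀ {m k} {r s : V k} {M N : Vector (V k) m} → r ≈ⱽ s → M ≈ᴿ N → r ∷ M ≈ᴿ s ∷ N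
  ∷-cong r≈s M≈N zero    = r≈s
  ∷-cong r≈s M≈N (suc i) = M≈N i

  ∷-isAltForm : ∀ {m k} r {D : Vector (V k) (suc m) → Carrier} →
                IsAltForm D → IsAltForm (λ M → D (r ∷ M))
  ∷-isAltForm r {D} D-alt = record
    { cong        = λ M≈N → cong (∷-cong (λ _ → refl) M≈N)
    ; linear      = λ M i a x y → begin
        D (r ∷ M [ i ]≔ (a · x +ⱽ y))                              ≈⟨ cong (∷-[]≔ r M i _) ⟩
        D ((r ∷ M) [ suc i ]≔ (a · x +ⱽ y))                        ≈⟨ linear (r ∷ M) (suc i) a x y ⟩
        a * D ((r ∷ M) [ suc i ]≔ x) + D ((r ∷ M) [ suc i ]≔ y)
          ≈⟨ +-cong (*-congˡ (cong (∷-[]≔ r M i x))) (cong (∷-[]≔ r M i y)) ⟨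
        a * D (r ∷ M [ i ]≔ x) + D (r ∷ M [ i ]≔ y)                ∎
    ; alternating = λ M i j i≢j Mᵢ≈Mⱼ → alternating (r ∷ M) (suc i) (suc j) (i≢j ∘ suc-injective) Mᵢ≈Mⱼ
    }
    where open IsAltForm D-alt

  -- Determinants

  sign : ℕ → Carrier
  sign t = (- 1#) ^ᶜ t

  1ᴹ-diag : ∀ {k} (i : Fin k) → 1ᴹ i i ≈ 1#
  1ᴹ-diag i with i ≟ i
  ... | yes _   = refl
  ... | no  i≢i = contradiction ≡.refl i≢i

  1ᴹ-off-diag : ∀ {k} {i j : Fin k} → i ≢ j → 1ᴹ i j ≈ 0#
  1ᴹ-off-diag {i = i} {j} i≢j with i ≟ j
  ... | yes i≡j = contradiction i≡j i≢j
  ... | no  _   = refl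

  sum-1ᴹ : ∀ {k} (x : V k) j → ∑[ l < k ] (x l * 1ᴹ l j) ≈ x j
  sum-1ᴹ {k} x j = begin
    ∑[ l < k ] (x l * 1ᴹ l j)
      ≈⟨ sum-single j _ (λ l l≢j → trans (*-congˡ (1ᴹ-off-diag l≢j)) (zeroʳ (x l))) ⟩
    x j * 1ᴹ j j               ≈⟨ *-congˡ (1ᴹ-diag j) ⟩
    x j * 1#                   ≈⟨ *-identityʳ (x j) ⟩
    x j                        ∎

  -- A pair `(j , l)` stands for the ordered pair of distinct columns `j` and `punchIn j l`. The
  -- hypothesis matches the columns (j, l + 1) with (l + 1, j), which exhausts all pairs. The
  -- induction splits off the pairs that involve column 0.
  antisymmetric-sum : ∀ n (f : Fin (suc n) → Fin n → Carrier) →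
                      (∀ j l → j Fin.≤ l → f (inject₁ j) l + f (suc l) j ≈ 0#) →
                      ∑[ j < suc n ] ∑[ l < n ] f j l ≈ 0#
  antisymmetric-sum zero    f anti = +-identityˡ 0#
  antisymmetric-sum (suc n) f anti = begin
    sum (f zero) + ∑[ j < suc n ] (f (suc j) zero + ∑[ l < n ] f (suc j) (suc l))
      ≈⟨ +-congˡ (∑-distrib-+ (λ j → f (suc j) zero) (λ j → ∑[ l < n ] f (suc j) (suc l))) ⟩
    sum (f zero) + (∑[ j < suc n ] f (suc j) zero + ∑[ j < suc n ] ∑[ l < n ] f (suc j) (suc l))
      ≈⟨ +-assoc _ _ _ ⟨
    (sum (f zero) + ∑[ j < suc n ] f (suc j) zero) + ∑[ j < suc n ] ∑[ l < n ] f (suc j) (suc l)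
      ≈⟨ +-cong (sym (∑-distrib-+ (f zero) (λ j → f (suc j) zero)))
                (antisymmetric-sum n (λ j l → f (suc j) (suc l))
                  (λ j l j≤l → anti (suc j) (suc l) (s≤s j≤l))) ⟩
    ∑[ j < suc n ] (f zero j + f (suc j) zero) + 0#
      ≈⟨ +-identityʳ _ ⟩
    ∑[ j < suc n ] (f zero j + f (suc j) zero)
      ≈⟨ sum-zero _ (λ j → anti zero j z≤n) ⟩
    0# ∎

  x+-1*x≈0 : ∀ x → x + - 1# * x ≈ 0#
  x+-1*x≈0 x = trans (+-congˡ (-1*x≈-x x)) (-‿inverseʳ x)

  punchIn-inject₁ : ∀ {n} (j l : Fin n) → j Fin.≤ l → punchIn (inject₁ j) l ≡ suc l
  punchIn-inject₁ zero    l       _         = ≡.refl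
  punchIn-inject₁ (suc j) (suc l) (s≤s j≤l) = ≡.cong suc (punchIn-inject₁ j l j≤l)

  punchIn-suc : ∀ {n} (j l : Fin n) → j Fin.≤ l → punchIn (suc l) j ≡ inject₁ j
  punchIn-suc zero    l       _         = ≡.refl
  punchIn-suc (suc j) (suc l) (s≤s j≤l) = ≡.cong suc (punchIn-suc j l j≤l)

  -- The cosimplicial identity: removing columns `j` and `l + 1` leaves the same columns in either
  -- order, the later column having index `l` once `j` is gone.
  punchIn-comm : ∀ {n} (j l : Fin (suc n)) (i : Fin n) → j Fin.≤ l →
                 punchIn (inject₁ j) (punchIn l i) ≡ punchIn (suc l) (punchIn j i)
  punchIn-comm zero    l       i       _         = ≡.refl
  punchIn-comm (suc j) (suc l) zero    _         = ≡.refl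
  punchIn-comm (suc j) (suc l) (suc i) (s≤s j≤l) = ≡.cong suc (punchIn-comm j l i j≤l)

  removeAt-isLinear : ∀ {k} (j : Fin (suc k)) → IsLinear (λ x → removeAt x j)
  removeAt-isLinear j = record
    { cong   = λ x≈y → x≈y ∘ punchIn j
    ; linear = λ a x y t → refl
    }

  -- With the first row fixed, each term of the expansion is a scaled pullback of the smaller
  -- determinant. This settles the lower rows in the induction of `det-isAltForm`; only row 0 needs
  -- separate treatment.
  laplace-isAltForm : ∀ {k} (r : V (suc k)) → IsAltForm (det {k}) →
    IsAltForm (λ M → ∑[ j < suc k ] (sign (toℕ j) * (r j * det (λ i → removeAt (M i) j))))
  laplace-isAltForm {k} r det-alt = sum-isAltForm (suc k) (λ j →
    scale-isAltForm (sign (toℕ j)) (scale-isAltForm (r j)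
      (pullback-isAltForm (removeAt-isLinear j) det-alt)))

  det-cong : ∀ {k} {M N : Matrix k} → M ≈ᴹ N → det M ≈ det N
  det-cong {zero}  M≈N = refl
  det-cong {suc k} M≈N = sum-cong-≋ λ j →
    *-congˡ {sign (toℕ j)} (*-cong (M≈N zero j) (det-cong λ i t → M≈N (suc i) (punchIn j t)))

  -- In the double expansion along the first two rows, the terms in which the
  -- same two columns are removed in the two possible orders cancel.
  det-equal-first-rows : ∀ {k} (M : Matrix (suc (suc k))) →
                         M zero ≈ⱽ M (suc zero) → det M ≈ 0#
  det-equal-first-rows {k} M M₀≈M₁ = begin
    det M
      ≈⟨ sum-cong-≋ (λ j → trans (sym (*-assoc _ _ _)) (trans
           (*-distribˡ-sum _ (λ l → sign (toℕ l) * (M₁ (punchIn j l) * minor j l)))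
           (sum-cong-≋ (λ l → push-in (sign (toℕ j)) (M₀ j) (sign (toℕ l)) (M₁ (punchIn j l)) (minor j l))))) ⟩
    ∑[ j < suc (suc k) ] ∑[ l < suc k ] f j l
      ≈⟨ antisymmetric-sum (suc k) f anti ⟩
    0# ∎
    where
    M₀ = M zero
    M₁ = M (suc zero)

    minor : Fin (suc (suc k)) → Fin (suc k) → Carrier
    minor j l = det (λ i → removeAt (removeAt (M (suc (suc i))) j) l)

    f : Fin (suc (suc k)) → Fin (suc k) → Carrier
    f j l = (sign (toℕ j) * sign (toℕ l)) * ((M₀ j * M₁ (punchIn j l)) * minor j l)

    anti : ∀ j l → j Fin.≤ l → f (inject₁ j) l + f (suc l) j ≈ 0#
    anti j l j≤l = begin
      f (inject₁ j) l + f (suc l) j   ≈⟨ +-cong f-inject₁ f-suc ⟩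
      x + - 1# * x                    ≈⟨ x+-1*x≈0 x ⟩
      0#                              ∎
      where
      x : Carrier
      x = (sign (toℕ j) * sign (toℕ l)) * ((M₀ (inject₁ j) * M₀ (suc l)) * minor (suc l) j)

      f-inject₁ : f (inject₁ j) l ≈ x
      f-inject₁ = *-cong
        (*-congʳ (reflexive (≡.cong sign (toℕ-inject₁ j))))
        (*-cong (*-congˡ (trans (reflexive (≡.cong M₁ (punchIn-inject₁ j l j≤l))) (sym (M₀≈M₁ (suc l)))))
                (det-cong λ i t →
                   reflexive (≡.cong (M (suc (suc i))) (punchIn-comm j l t j≤l))))

      -- `inject₁ j` has the same sign as `j`, while `suc l` has one more factor - 1 than `l`. This
      -- shift is the source of the cancellation.
      f-suc : f (suc l) j ≈ - 1# * x
      f-suc = begin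
        f (suc l) j
          ≈⟨ *-congˡ (*-congʳ (*-congˡ
               (trans (reflexive (≡.cong M₁ (punchIn-suc j l j≤l))) (sym (M₀≈M₁ (inject₁ j)))))) ⟩
        ((- 1# * sign (toℕ l)) * sign (toℕ j)) * ((M₀ (suc l) * M₀ (inject₁ j)) * minor (suc l) j)
          ≈⟨ pull-sign (- 1#) (sign (toℕ j)) (sign (toℕ l)) (M₀ (suc l)) (M₀ (inject₁ j)) (minor (suc l) j) ⟩
        - 1# * x ∎

  -- If the copy of row 0 is not already row 1, exchange it with row 1. The rows below row 0 form an
  -- alternating form by induction, so `swap` makes the two determinants opposite, and the exchanged
  -- one vanishes by `det-equal-first-rows`.
  det-equal-rows₀ : ∀ {k} → IsAltForm (det {k}) → (M : Matrix (suc k)) → ∀ j →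
                    M zero ≈ⱽ M (suc j) → det M ≈ 0#
  det-equal-rows₀ {suc k} det-alt M zero    M₀≈M₁ = det-equal-first-rows M M₀≈M₁
  det-equal-rows₀ {suc k} det-alt M (suc j) M₀≈Mⱼ = begin
    det M                                                        ≈⟨ cong T-self ⟨
    D (T [ zero ]≔ T₀ [ suc j ]≔ M₀)                             ≈⟨ +-identityʳ _ ⟨
    D (T [ zero ]≔ T₀ [ suc j ]≔ M₀) + 0#
      ≈⟨ +-congˡ (det-equal-first-rows (M₀ ∷ T [ zero ]≔ M₀ [ suc j ]≔ T₀) (λ _ → refl)) ⟨
    D (T [ zero ]≔ T₀ [ suc j ]≔ M₀) + D (T [ zero ]≔ M₀ [ suc j ]≔ T₀)
      ≈⟨ swap T zero (suc j) 0≢1+n T₀ M₀ ⟩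
    0#                                                           ∎
    where
    M₀ = M zero
    T  = tail M
    T₀ = T zero

    D : Vector (V (suc (suc k))) (suc k) → Carrier
    D X = det (M₀ ∷ X)

    open IsAltForm (laplace-isAltForm M₀ det-alt)

    T-self : T [ zero ]≔ T₀ [ suc j ]≔ M₀ ≈ᴿ T
    T-self i t = trans ([]≔-self (T [ zero ]≔ T₀) (suc j) M₀≈Mⱼ i t) ([]≔-self T zero (λ _ → refl) i t)

  det-isAltForm : ∀ k → IsAltForm (det {k})
  det-isAltForm zero    = record
    { cong        = λ _ → refl
    ; linear      = λ _ ()
    ; alternating = λ _ ()
    }
  det-isAltForm (suc k) = record
    { cong        = det-cong
    ; linear      = linear
    ; alternating = alternating
    }
    where
    module tail r = IsAltForm (laplace-isAltForm r (det-isAltForm k))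

    linear : ∀ M i a x y → det (M [ i ]≔ (a · x +ⱽ y)) ≈ a * det (M [ i ]≔ x) + det (M [ i ]≔ y)
    linear M zero    a x y = sum-linear (suc k) a _ _ _ λ j →
      det-row-linear (sign (toℕ j)) (det (λ i → removeAt (M (suc i)) j)) a (x j) (y j)
    linear M (suc i) a x y = tail.linear (M zero) (tail M) i a x y

    alternating : ∀ M i j → i ≢ j → M i ≈ⱽ M j → det M ≈ 0#
    alternating M zero    zero    i≢j _     = contradiction ≡.refl i≢j
    alternating M zero    (suc j) i≢j Mᵢ≈Mⱼ = det-equal-rows₀ (det-isAltForm k) M j Mᵢ≈Mⱼ
    alternating M (suc i) zero    i≢j Mᵢ≈Mⱼ = det-equal-rows₀ (det-isAltForm k) M i (λ t → sym (Mᵢ≈Mⱼ t))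
    alternating M (suc i) (suc j) i≢j Mᵢ≈Mⱼ = tail.alternating (M zero) (tail M) i j (i≢j ∘ ≡.cong suc) Mᵢ≈Mⱼ

  -- Uniqueness of alternating forms

  rowwise : ∀ {m k r} {D : Vector (V k) m → Carrier} (_∼_ : V k → V k → Set r) →
            (∀ {M N} → M ≈ᴿ N → D M ≈ D N) →
            (∀ M i x y → x ∼ y → D (M [ i ]≔ x) ≈ D (M [ i ]≔ y)) →
            ∀ M N → (∀ i → M i ∼ N i) → D M ≈ D N
  rowwise {zero}          _∼_ D-cong step M N M∼N = D-cong λ ()
  rowwise {suc m} {D = D} _∼_ D-cong step M N M∼N = begin
    D M                       ≈⟨ D-cong ([]≔-self M zero (λ _ → refl)) ⟨
    D (M [ zero ]≔ M zero)    ≈⟨ step M zero _ _ (M∼N zero) ⟩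
    D (M [ zero ]≔ N zero)    ≈⟨ D-cong (λ { zero _ → refl ; (suc i) _ → refl }) ⟩
    D (N zero ∷ tail M)
      -- The row already replaced is absorbed into the function, which is why `D` is arbitrary and
      -- `step` allows any surrounding rows.
      ≈⟨ rowwise {D = λ X → D (N zero ∷ X)} _∼_ (λ X≈Y → D-cong (∷-cong (λ _ → refl) X≈Y))
           (λ X i x y x∼y → trans (D-cong (∷-[]≔ _ X i x))
             (trans (step _ (suc i) x y x∼y) (sym (D-cong (∷-[]≔ _ X i y)))))
           (tail M) (tail N) (M∼N ∘ suc) ⟩
    D (N zero ∷ tail N)       ≈⟨ D-cong (λ { zero _ → refl ; (suc i) _ → refl }) ⟩
    D N                       ∎

  -- A multiple of `e` added to a lower row contributes a form with `e` in two rows. With `e` a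
  -- standard basis vector, this clears a column below the first row.
  ∷-shear : ∀ {m k} {D : Vector (V k) (suc m) → Carrier} → IsAltForm D → ∀ e M N →
            (∀ i → ∃[ a ] M i ≈ⱽ a · e +ⱽ N i) → D (e ∷ M) ≈ D (e ∷ N)
  ∷-shear {m} {k} {D} D-alt e = rowwise {D = λ M → D (e ∷ M)} (λ x y → ∃[ a ] x ≈ⱽ a · e +ⱽ y) e∷.cong step
    where
    module e∷ = IsAltForm (∷-isAltForm e D-alt)

    step : ∀ (M : Vector (V k) m) i x y → ∃[ a ] x ≈ⱽ a · e +ⱽ y → D (e ∷ M [ i ]≔ x) ≈ D (e ∷ M [ i ]≔ y)
    step M i x y (a , x≈) = begin
      D (e ∷ M [ i ]≔ x)
        ≈⟨ e∷.cong ([]≔-cong i (λ _ _ → refl) x≈) ⟩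
      D (e ∷ M [ i ]≔ (a · e +ⱽ y))                         ≈⟨ e∷.linear M i a e y ⟩
      a * D (e ∷ M [ i ]≔ e) + D (e ∷ M [ i ]≔ y)
        ≈⟨ +-congʳ (trans (*-congˡ repeated) (zeroʳ a)) ⟩
      0# + D (e ∷ M [ i ]≔ y)                               ≈⟨ +-identityˡ _ ⟩
      D (e ∷ M [ i ]≔ y)                                    ∎
      where
      repeated : D (e ∷ M [ i ]≔ e) ≈ 0#
      repeated = IsAltForm.alternating D-alt _ zero (suc i) 0≢1+n (≡⇒≈ⱽ (≡.sym (updateAt-updates i M)))

  insertAt-0-isLinear : ∀ {k} (j : Fin (suc k)) → IsLinear (λ (x : V k) → insertAt x j 0#)
  insertAt-0-isLinear j = record { cong = cong j ; linear = linear j }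
    where
    cong : ∀ {k} (j : Fin (suc k)) {x y : V k} → x ≈ⱽ y → insertAt x j 0# ≈ⱽ insertAt y j 0#
    cong         zero    x≈y zero    = refl
    cong         zero    x≈y (suc t) = x≈y t
    cong {suc k} (suc j) x≈y zero    = x≈y zero
    cong {suc k} (suc j) x≈y (suc t) = cong j (x≈y ∘ suc) t

    linear : ∀ {k} (j : Fin (suc k)) a (x y : V k) →
             insertAt (a · x +ⱽ y) j 0# ≈ⱽ a · insertAt x j 0# +ⱽ insertAt y j 0#
    linear         zero    a x y zero    = sym (trans (+-identityʳ _) (zeroʳ a))
    linear         zero    a x y (suc t) = refl
    linear {suc k} (suc j) a x y zero    = refl
    linear {suc k} (suc j) a x y (suc t) = linear j a (tail x) (tail y) t

  insertAt-0ⱽ : ∀ {k} (j : Fin (suc k)) → insertAt 0ⱽ j 0# ≈ⱽ 0ⱽ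
  insertAt-0ⱽ         zero    zero    = refl
  insertAt-0ⱽ         zero    (suc t) = refl
  insertAt-0ⱽ {suc k} (suc j) zero    = refl
  insertAt-0ⱽ {suc k} (suc j) (suc t) = insertAt-0ⱽ j t

  insertAt-1ᴹ : ∀ {k} (j : Fin (suc k)) (i : Fin k) → insertAt (1ᴹ i) j 0# ≈ⱽ 1ᴹ (punchIn j i)
  insertAt-1ᴹ zero    i       zero    = refl
  insertAt-1ᴹ zero    i       (suc t) = refl
  insertAt-1ᴹ (suc j) zero    zero    = refl
  insertAt-1ᴹ (suc j) zero    (suc t) = insertAt-0ⱽ j t
  insertAt-1ᴹ (suc j) (suc i) zero    = refl
  insertAt-1ᴹ (suc j) (suc i) (suc t) = insertAt-1ᴹ j i t

  -- Moving the gap from `j` to `j + 1` affects only position `j`, whose value drops from `j + 1` to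
  -- `j`.
  punchIn-suc-[]≔ : ∀ {k} (j : Fin k) → punchIn (suc j) ≗ punchIn (inject₁ j) [ j ]≔ inject₁ j
  punchIn-suc-[]≔ zero    zero    = ≡.refl
  punchIn-suc-[]≔ zero    (suc i) = ≡.refl
  punchIn-suc-[]≔ (suc j) zero    = ≡.refl
  punchIn-suc-[]≔ (suc j) (suc i) = ≡.trans (≡.cong suc (punchIn-suc-[]≔ j i))
    (map-updateAt {f = suc} {g = const (inject₁ j)} {h = const (suc (inject₁ j))}
      (λ _ → ≡.refl) (punchIn (inject₁ j)) j i)

  -- The permutation matrix of a cycle of length `toℕ j + 1`; the sign of this cycle is the sign in
  -- the Laplace expansion.
  1ᴹ-row-first : ∀ {k} → Fin (suc k) → Matrix (suc k)
  1ᴹ-row-first j = 1ᴹ j ∷ 1ᴹ ∘ punchIn j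

  -- Going from j to j + 1 exchanges rows 0 and j + 1.
  form-1ᴹ-row-first : ∀ {k} {D : Matrix (suc k) → Carrier} → IsAltForm D →
                      ∀ j → D (1ᴹ-row-first j) ≈ sign (toℕ j) * D 1ᴹ
  form-1ᴹ-row-first {k} {D} D-alt = <-weakInduction _ base step
    where
    open IsAltForm D-alt
    E = 1ᴹ-row-first

    base : D (E zero) ≈ sign 0 * D 1ᴹ
    base = trans (cong λ { zero _ → refl ; (suc i) _ → refl }) (sym (*-identityˡ _))

    E-inject₁ : ∀ j → E (inject₁ j) [ zero ]≔ 1ᴹ (inject₁ j) [ suc j ]≔ 1ᴹ (suc j) ≈ᴿ E (inject₁ j)
    E-inject₁ j i t = trans
      ([]≔-self (E (inject₁ j) [ zero ]≔ 1ᴹ (inject₁ j)) (suc j)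
        (λ t → reflexive (≡.cong (λ l → 1ᴹ l t) (≡.sym (punchIn-inject₁ j j ≤-refl)))) i t)
      ([]≔-self (E (inject₁ j)) zero (λ _ → refl) i t)

    E-suc : ∀ j → E (inject₁ j) [ zero ]≔ 1ᴹ (suc j) [ suc j ]≔ 1ᴹ (inject₁ j) ≈ᴿ E (suc j)
    E-suc j zero    t = refl
    E-suc j (suc i) t = reflexive (≡.cong (_$ t) (≡.sym (≡.trans (≡.cong 1ᴹ (punchIn-suc-[]≔ j i))
      (map-updateAt {f = 1ᴹ} {g = const (inject₁ j)} {h = const (1ᴹ (inject₁ j))}
        (λ _ → ≡.refl) (punchIn (inject₁ j)) j i))))

    step : ∀ j → D (E (inject₁ j)) ≈ sign (toℕ (inject₁ j)) * D 1ᴹ → D (E (suc j)) ≈ sign (suc (toℕ j)) * D 1ᴹ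
    step j IH = begin
      D (E (suc j))
        ≈⟨ +-inverseʳ-unique _ _ (trans
             (sym (+-cong (cong (E-inject₁ j)) (cong (E-suc j))))
             (swap (E (inject₁ j)) zero (suc j) 0≢1+n _ _)) ⟩
      - D (E (inject₁ j))                        ≈⟨ -1*x≈-x _ ⟨
      - 1# * D (E (inject₁ j))                   ≈⟨ *-congˡ IH ⟩
      - 1# * (sign (toℕ (inject₁ j)) * D 1ᴹ)
        ≈⟨ *-congˡ (*-congʳ (reflexive (≡.cong sign (toℕ-inject₁ j)))) ⟩
      - 1# * (sign (toℕ j) * D 1ᴹ)                 ≈⟨ *-assoc _ _ _ ⟨
      sign (suc (toℕ j)) * D 1ᴹ                    ∎

  -- Row 0 is expanded in the standard basis. With `1ᴹ j` as first row, shearing clears column `j`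
  -- below it, and what remains is an alternating form in the rows of the minor, to which the
  -- induction hypothesis applies. Its value at the identity is that of `D` at a permutation matrix.
  isAltForm⇒det : ∀ {k} {D : Matrix k → Carrier} → IsAltForm D → ∀ M → D M ≈ det M * D 1ᴹ
  isAltForm⇒det {zero}  {D} D-alt M = trans (IsAltForm.cong D-alt λ ()) (sym (*-identityˡ _))
  isAltForm⇒det {suc k} {D} D-alt M = begin
    D M
      ≈⟨ cong ([]≔-self M zero (sum-1ᴹ (M zero))) ⟨
    D (M [ zero ]≔ (λ t → ∑[ j < suc k ] (M zero j * 1ᴹ j t)))
      ≈⟨ linear-sum M zero (M zero) 1ᴹ ⟩
    ∑[ j < suc k ] (M zero j * D (M [ zero ]≔ 1ᴹ j))
      ≈⟨ sum-cong-≋ (λ j → trans (*-congˡ (term j))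
           (collect (M zero j) (det (minor j)) (sign (toℕ j)) (D 1ᴹ))) ⟩
    ∑[ j < suc k ] ((sign (toℕ j) * (M zero j * det (minor j))) * D 1ᴹ)
      ≈⟨ *-distribʳ-sum (D 1ᴹ) (λ j → sign (toℕ j) * (M zero j * det (minor j))) ⟨
    det M * D 1ᴹ ∎
    where
    open IsAltForm D-alt

    minor : Fin (suc k) → Matrix k
    minor j i = removeAt (M (suc i)) j

    term : ∀ j → D (M [ zero ]≔ 1ᴹ j) ≈ det (minor j) * (sign (toℕ j) * D 1ᴹ)
    term j = begin
      D (M [ zero ]≔ 1ᴹ j)
        ≈⟨ cong (λ { zero _ → refl ; (suc i) _ → refl }) ⟩
      D (1ᴹ j ∷ tail M)
        ≈⟨ ∷-shear D-alt (1ᴹ j) (tail M) (inserted ∘ minor j) (λ i → M (suc i) j , split (M (suc i))) ⟩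
      D (1ᴹ j ∷ inserted ∘ minor j)
        ≈⟨ isAltForm⇒det (pullback-isAltForm (insertAt-0-isLinear j) (∷-isAltForm (1ᴹ j) D-alt)) (minor j) ⟩
      det (minor j) * D (1ᴹ j ∷ inserted ∘ 1ᴹ)
        ≈⟨ *-congˡ (cong (∷-cong (λ _ → refl) (insertAt-1ᴹ j))) ⟩
      det (minor j) * D (1ᴹ-row-first j)                 ≈⟨ *-congˡ (form-1ᴹ-row-first D-alt j) ⟩
      det (minor j) * (sign (toℕ j) * D 1ᴹ)                ∎
      where
      inserted : V k → V (suc k)
      inserted x = insertAt x j 0#

      split : ∀ x → x ≈ⱽ x j · 1ᴹ j +ⱽ inserted (removeAt x j)
      split x t with j ≟ t
      ... | yes ≡.refl = sym (trans
              (+-cong (*-identityʳ _) (reflexive (insertAt-lookup (removeAt x j) j 0#)))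
              (+-identityʳ _))
      ... | no  j≢t    = sym (trans (+-cong (zeroʳ _) (reflexive (≡.trans
              (≡.cong (insertAt (removeAt x j) j 0#) (≡.sym (punchIn-punchOut j≢t)))
              (≡.trans (insertAt-punchIn (removeAt x j) j 0# (punchOut j≢t)) (removeAt-punchOut x j≢t)))))
            (+-identityˡ _))

  -- Matrix products and multiplicativity of the determinant

  *ⱽ-congʳ : ∀ {k} (A : Matrix k) {x y} → x ≈ⱽ y → A *ⱽ x ≈ⱽ A *ⱽ y
  *ⱽ-congʳ A x≈y i = sum-cong-≋ λ j → *-congˡ (x≈y j)

  *ⱽ-congˡ : ∀ {k} {A B : Matrix k} x → A ≈ᴹ B → A *ⱽ x ≈ⱽ B *ⱽ x
  *ⱽ-congˡ x A≈B i = sum-cong-≋ λ j → *-congʳ (A≈B i j)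

  *ⱽ-assoc : ∀ {k} (A B : Matrix k) x → (A *ᴹ B) *ⱽ x ≈ⱽ A *ⱽ (B *ⱽ x)
  *ⱽ-assoc {k} A B x i = begin
    ∑[ j < k ] (∑[ l < k ] (A i l * B l j) * x j)
      ≈⟨ sum-cong-≋ (λ j → trans (*-distribʳ-sum (x j) (λ l → A i l * B l j))
           (sum-cong-≋ λ l → *-assoc (A i l) (B l j) (x j))) ⟩
    ∑[ j < k ] ∑[ l < k ] (A i l * (B l j * x j))
      ≈⟨ ∑-comm (λ j l → A i l * (B l j * x j)) ⟩
    ∑[ l < k ] ∑[ j < k ] (A i l * (B l j * x j))
      ≈⟨ sum-cong-≋ (λ l → *-distribˡ-sum (A i l) (λ j → B l j * x j)) ⟨
    ∑[ l < k ] (A i l * ∑[ j < k ] (B l j * x j)) ∎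

  *ⱽ-identityˡ : ∀ {k} (x : V k) → 1ᴹ *ⱽ x ≈ⱽ x
  *ⱽ-identityˡ x i = begin
    sum (λ j → 1ᴹ i j * x j)
      ≈⟨ sum-single i _ (λ j j≢i → trans (*-congʳ (1ᴹ-off-diag (j≢i ∘ ≡.sym))) (zeroˡ (x j))) ⟩
    1ᴹ i i * x i               ≈⟨ *-congʳ (1ᴹ-diag i) ⟩
    1# * x i                   ≈⟨ *-identityˡ (x i) ⟩
    x i                        ∎

  *ⱽ-- : ∀ {k} (A : Matrix k) x y → A *ⱽ (λ j → x j - y j) ≈ⱽ λ i → (A *ⱽ x) i - (A *ⱽ y) i
  *ⱽ-- {k} A x y i = begin
    ∑[ j < k ] (A i j * (x j - y j))
      ≈⟨ sum-linear k (- 1#) _ (λ j → A i j * y j) (λ j → A i j * x j) (λ j → row (A i j) (x j) (y j)) ⟩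
    - 1# * (A *ⱽ y) i + (A *ⱽ x) i          ≈⟨ +-congʳ (-1*x≈-x _) ⟩
    - (A *ⱽ y) i + (A *ⱽ x) i               ≈⟨ +-comm _ _ ⟩
    (A *ⱽ x) i - (A *ⱽ y) i                 ∎
    where
    row : ∀ a x y → a * (x - y) ≈ - 1# * (a * y) + a * x
    row a x y = begin
      a * (x - y)               ≈⟨ *-congˡ (+-congˡ (-1*x≈-x y)) ⟨
      a * (x + - 1# * y)
        ≈⟨ solve 4 (λ ε a x y → a :* (x :+ ε :* y) := ε :* (a :* y) :+ a :* x) refl (- 1#) a x y ⟩
      - 1# * (a * y) + a * x    ∎

  det-1ᴹ : ∀ {k} → det (1ᴹ {k}) ≈ 1#
  det-1ᴹ {zero}  = refl
  det-1ᴹ {suc k} = begin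
    det (1ᴹ {suc k})          ≈⟨ sum-single zero term off-diagonal ⟩
    1# * (1# * det (1ᴹ {k}))  ≈⟨ trans (*-identityˡ _) (*-identityˡ _) ⟩
    det (1ᴹ {k})              ≈⟨ det-1ᴹ {k} ⟩
    1#                        ∎
    where
    term : Fin (suc k) → Carrier
    term j = sign (toℕ j) * (1ᴹ {suc k} zero j * det (λ i → removeAt (1ᴹ (suc i)) j))

    off-diagonal : ∀ j → j ≢ zero → term j ≈ 0#
    off-diagonal j j≢0 = trans
      (*-congˡ (trans (*-congʳ (1ᴹ-off-diag (j≢0 ∘ ≡.sym))) (zeroˡ _))) (zeroʳ (sign (toℕ j)))

  -- The rows of `A *ᴹ B` are the images of the rows of `A` under x ↦ xB, so for fixed `B` the left
  -- side is an alternating form in `A`, with value `det B` at the identity.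
  det-* : ∀ {k} (A B : Matrix k) → det (A *ᴹ B) ≈ det A * det B
  det-* {k} A B = begin
    det (A *ᴹ B)
      ≈⟨ isAltForm⇒det (pullback-isAltForm B-isLinear (det-isAltForm k)) A ⟩
    det A * det (1ᴹ *ᴹ B)      ≈⟨ *-congˡ (det-cong λ i j → *ⱽ-identityˡ (λ l → B l j) i) ⟩
    det A * det B              ∎
    where
    B-isLinear : IsLinear {k} {k} (λ x j → ∑[ l < k ] (x l * B l j))
    B-isLinear = record
      { cong   = λ x≈y j → sum-cong-≋ λ l → *-congʳ (x≈y l)
      ; linear = λ a x y j → sum-linear k a _ _ _ λ l →
          solve 4 (λ a x y b → (a :* x :+ y) :* b := a :* (x :* b) :+ y :* b) refl
            a (x l) (y l) (B l j)
      }

  *-GL : ∀ {k} {A B : Matrix k} → A ∈ GL k → B ∈ GL k → A *ᴹ B ∈ GL k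
  *-GL {k} {A} {B} (A⁻¹ , A⁻¹A≈1 , AA⁻¹≈1) (B⁻¹ , B⁻¹B≈1 , BB⁻¹≈1) =
    B⁻¹ *ᴹ A⁻¹ , cancel-inner B⁻¹ A⁻¹ A B A⁻¹A≈1 B⁻¹B≈1 , cancel-inner A B B⁻¹ A⁻¹ BB⁻¹≈1 AA⁻¹≈1
    where
    cancel-inner : ∀ (P Q R S : Matrix k) → Q *ᴹ R ≈ᴹ 1ᴹ → P *ᴹ S ≈ᴹ 1ᴹ → (P *ᴹ Q) *ᴹ (R *ᴹ S) ≈ᴹ 1ᴹ
    -- Column `j` of a product is by definition the left factor applied to column `j` of the right
    -- one, so `*ⱽ-assoc` can regroup the four factors.
    cancel-inner P Q R S QR≈1 PS≈1 i j = begin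
      ((P *ᴹ Q) *ᴹ (R *ᴹ S)) i j    ≈⟨ *ⱽ-assoc P Q _ i ⟩
      (P *ⱽ (Q *ⱽ (R *ⱽ s))) i
        ≈⟨ *ⱽ-congʳ P (λ t → trans (sym (*ⱽ-assoc Q R s t))
             (trans (*ⱽ-congˡ s QR≈1 t) (*ⱽ-identityˡ s t))) i ⟩
      (P *ᴹ S) i j                  ≈⟨ PS≈1 i j ⟩
      1ᴹ i j                        ∎
      where s = λ l → S l j

  -- Dilations

  infix 7 _∙_
  _∙_ : ∀ {k} → V k → V k → Carrier
  x ∙ y = sum λ t → x t * y t

  -- The rank-one update I + a eⱼ lᵀ, that is, x ↦ x + a (l ∙ x) eⱼ. When `l j` is 1 it multiplies
  -- eⱼ by 1 + a, so `a` is the dilation factor minus one.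
  dilation : ∀ {k} → V k → Fin k → Carrier → Matrix k
  dilation l j a i t = 1ᴹ i t + 1ᴹ i j * (a * l t)

  module _ {k} (l : V k) (j : Fin k) where

    private D = dilation l j

    dilation-*ⱽ : ∀ a x i → (D a *ⱽ x) i ≈ x i + 1ᴹ i j * (a * (l ∙ x))
    dilation-*ⱽ a x i = begin
      sum (λ t → (1ᴹ i t + 1ᴹ i j * (a * l t)) * x t)
        ≈⟨ sum-linear k (1ᴹ i j * a) _ (λ t → l t * x t) (λ t → 1ᴹ i t * x t)
             (λ t → solve 5 (λ d e a l x → (d :+ e :* (a :* l)) :* x := (e :* a) :* (l :* x) :+ d :* x) refl
               (1ᴹ i t) (1ᴹ i j) a (l t) (x t)) ⟩
      (1ᴹ i j * a) * (l ∙ x) + (1ᴹ *ⱽ x) i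
        ≈⟨ +-cong (*-assoc _ _ _) (*ⱽ-identityˡ x i) ⟩
      1ᴹ i j * (a * (l ∙ x)) + x i                     ≈⟨ +-comm _ _ ⟩
      x i + 1ᴹ i j * (a * (l ∙ x))                     ∎

    dilation-fixes : ∀ a x → l ∙ x ≈ 0# → D a *ⱽ x ≈ⱽ x
    dilation-fixes a x l∙x≈0 i = begin
      (D a *ⱽ x) i              ≈⟨ dilation-*ⱽ a x i ⟩
      x i + 1ᴹ i j * (a * (l ∙ x))
        ≈⟨ +-congˡ (trans (*-congˡ (trans (*-congˡ l∙x≈0) (zeroʳ a))) (zeroʳ _)) ⟩
      x i + 0#                         ≈⟨ +-identityʳ _ ⟩
      x i                              ∎

    module _ (lⱼ≈1 : l j ≈ 1#) where

      -- `l` is a left eigenvector with eigenvalue 1 + a, because `l` takes the value 1 on eⱼ. Hence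
      -- the factors of successive dilations multiply.
      ∙-dilation : ∀ a x → l ∙ (D a *ⱽ x) ≈ l ∙ x + a * (l ∙ x)
      ∙-dilation a x = begin
        sum (λ t → l t * (D a *ⱽ x) t)
          ≈⟨ sum-linear k (a * (l ∙ x)) _ (λ t → l t * 1ᴹ t j) (λ t → l t * x t)
               (λ t → trans (*-congˡ (dilation-*ⱽ a x t))
                 (solve 4 (λ l x d s → l :* (x :+ d :* s) := s :* (l :* d) :+ l :* x) refl
                   (l t) (x t) (1ᴹ t j) (a * (l ∙ x)))) ⟩
        (a * (l ∙ x)) * sum (λ t → l t * 1ᴹ t j) + l ∙ x
          ≈⟨ +-congʳ (trans (*-congˡ (trans (sum-1ᴹ l j) lⱼ≈1)) (*-identityʳ _)) ⟩
        a * (l ∙ x) + l ∙ x                             ≈⟨ +-comm _ _ ⟩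
        l ∙ x + a * (l ∙ x)                             ∎

      dilation-inverse : ∀ a b → (1# + a) * (1# + b) ≈ 1# → D a *ᴹ D b ≈ᴹ 1ᴹ
      dilation-inverse a b [1+a][1+b]≈1 i t = begin
        (D a *ⱽ col) i                            ≈⟨ *ⱽ-congʳ (D a) col≈ i ⟩
        (D a *ⱽ (D b *ⱽ e)) i              ≈⟨ dilation-*ⱽ a (D b *ⱽ e) i ⟩
        (D b *ⱽ e) i + δ * (a * (l ∙ (D b *ⱽ e)))
          ≈⟨ +-cong (dilation-*ⱽ b e i) (*-congˡ (*-congˡ (∙-dilation b e))) ⟩
        (e i + δ * (b * s)) + δ * (a * (s + b * s))
          ≈⟨ solve 5 (λ e d a b s → (e :+ d :* (b :* s)) :+ d :* (a :* (s :+ b :* s)) :=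
                                    e :+ d :* (b :* s :+ a :* (s :+ b :* s))) refl (e i) δ a b s ⟩
        e i + δ * (b * s + a * (s + b * s))
          ≈⟨ +-congˡ (trans (*-congˡ (+-identityʳ-unique s _ cancels)) (zeroʳ δ)) ⟩
        e i + 0#                                         ≈⟨ +-identityʳ _ ⟩
        1ᴹ i t                                           ∎
        where
        e col : V k
        e r = 1ᴹ r t
        col r = D b r t
        δ = 1ᴹ i j
        s = l ∙ e

        col≈ : col ≈ⱽ D b *ⱽ e
        col≈ r = sym (sum-1ᴹ (D b r) t)

        -- The coefficient of eⱼ is ((1 + a)(1 + b) - 1)s. Adding `s` to it gives an identity
        -- without subtraction, and cancelling `s` then shows that the coefficient is zero.
        cancels : s + (b * s + a * (s + b * s)) ≈ s
        cancels = begin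
          s + (b * s + a * (s + b * s))
            ≈⟨ solve 3 (λ s a b → s :+ (b :* s :+ a :* (s :+ b :* s)) :=
                                  (con 1 :+ a) :* (con 1 :+ b) :* s) refl s a b ⟩
          (1# + a) * (1# + b) * s
            ≈⟨ trans (*-congʳ [1+a][1+b]≈1) (*-identityˡ s) ⟩
          s                                           ∎

      -- Only row `j` differs from the identity matrix, and its coefficients in the standard basis
      -- are its own entries, so `row-combination` yields the diagonal entry.
      det-dilation : ∀ a → det (D a) ≈ 1# + a
      det-dilation a = begin
        det (D a)                                              ≈⟨ det-cong dilation≈ ⟩
        det (1ᴹ [ j ]≔ (λ t → ∑[ r < k ] (D a j r * 1ᴹ r t)))
          ≈⟨ IsAltForm.row-combination (det-isAltForm k) (1ᴹ {k}) j (D a j) ⟩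
        D a j j * det (1ᴹ {k})
          ≈⟨ trans (*-congˡ (det-1ᴹ {k})) (*-identityʳ _) ⟩
        1ᴹ j j + 1ᴹ j j * (a * l j)
          ≈⟨ +-cong (1ᴹ-diag j) (trans (*-congʳ (1ᴹ-diag j)) (*-identityˡ _)) ⟩
        1# + a * l j
          ≈⟨ +-congˡ (trans (*-congˡ lⱼ≈1) (*-identityʳ a)) ⟩
        1# + a                                                        ∎
        where
        dilation≈ : D a ≈ᴹ 1ᴹ [ j ]≔ (λ t → ∑[ r < k ] (D a j r * 1ᴹ r t))
        dilation≈ i t = by-cases (i ≟ j)
          where
          by-cases : Dec (i ≡ j) → D a i t ≈ (1ᴹ [ j ]≔ (λ t → ∑[ r < k ] (D a j r * 1ᴹ r t))) i t
          by-cases (yes ≡.refl) = sym (trans (≡⇒≈ⱽ (updateAt-updates j 1ᴹ) t) (sum-1ᴹ (D a j) t))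
          by-cases (no  i≢j)    = begin
            1ᴹ i t + 1ᴹ i j * (a * l t)   ≈⟨ +-congˡ (trans (*-congʳ (1ᴹ-off-diag i≢j)) (zeroˡ _)) ⟩
            1ᴹ i t + 0#                   ≈⟨ +-identityʳ _ ⟩
            1ᴹ i t                        ≈⟨ ≡⇒≈ⱽ (updateAt-minimal i j 1ᴹ i≢j) t ⟨
            (1ᴹ [ j ]≔ (λ t → ∑[ r < k ] (D a j r * 1ᴹ r t))) i t ∎

  -- Common normals of few vectors

  _≈?_ : ∀ x y → Dec (x ≈ y)
  -- Elements are compared through their indices in the finite enumeration; the search for a pivot
  -- below relies on this.
  x ≈? y = map′
    (λ eq → trans (sym (strictlyInverseˡ x)) (trans (reflexive (≡.cong to eq)) (strictlyInverseˡ y)))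
    from-cong (from x ≟ from y)
    where open Inverse enumeration

  inverse : ∀ x → ¬ x ≈ 0# → ∃[ w ] w * x ≈ 1#
  inverse x x≉0 with invertible x x≉0
  ... | w , wx≈1 , _ = w , wx≈1

  -- Gaussian elimination of the first coordinate.
  common-normal : ∀ {m k} → m < k → (u : Vector (V k) m) →
                  ∃[ l ] ∃[ j ] l j ≈ 1# × (∀ i → l ∙ u i ≈ 0#)
  common-normal {zero}  {suc k} _         u = 1ᴹ zero , zero , refl , λ ()
  common-normal {suc m} {suc k} (s≤s m<k) u with any? (λ i → ¬? (u i zero ≈? 0#))
  ... | no  all-0 = 1ᴹ zero , zero , refl , λ i →
    trans (*ⱽ-identityˡ (u i) zero) (decidable-stable (u i zero ≈? 0#) (λ ≉0 → all-0 (i , ≉0)))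
  ... | yes (p , uₚ₀≉0) with inverse (u p zero) uₚ₀≉0
  ... | w , wuₚ₀≈1 = extend (common-normal m<k reduced)
    where
    multiplier : Fin m → Carrier
    -- Chosen so that adding this multiple of `u p` to `u (punchIn p i)` gives first coordinate 0;
    -- `reduced` keeps the other coordinates.
    multiplier i = - (w * u (punchIn p i) zero)

    reduced : Vector (V k) m
    reduced i = multiplier i · tail (u p) +ⱽ tail (u (punchIn p i))

    extend : ∃[ l ] ∃[ j ] l j ≈ 1# × (∀ i → l ∙ reduced i ≈ 0#) →
             ∃[ l ] ∃[ j ] l j ≈ 1# × (∀ i → l ∙ u i ≈ 0#)
    -- The new first entry solves the equation x * u p zero + s = 0 of orthogonality to the pivot
    -- vector. The entry equal to 1 moves from `j` to `suc j`.
    extend (l , j , lⱼ≈1 , l⊥) = (- (w * s)) ∷ l , suc j , lⱼ≈1 , ⊥u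
      where
      s : Carrier
      s = l ∙ tail (u p)

      negate-swap : ∀ x → - (w * s) * x ≈ - (w * x) * s
      negate-swap x = begin
        - (w * s) * x      ≈⟨ -‿distribˡ-* _ x ⟨
        - (w * s * x)      ≈⟨ -‿cong (solve 3 (λ w s x → w :* s :* x := w :* x :* s) refl w s x) ⟩
        - (w * x * s)      ≈⟨ -‿distribˡ-* _ s ⟩
        - (w * x) * s      ∎

      ⊥uₚ : - (w * s) * u p zero + s ≈ 0#
      ⊥uₚ = begin
        - (w * s) * u p zero + s       ≈⟨ +-congʳ (negate-swap (u p zero)) ⟩
        - (w * u p zero) * s + s       ≈⟨ +-congʳ (*-congʳ (-‿cong wuₚ₀≈1)) ⟩
        - 1# * s + s                   ≈⟨ +-congʳ (-1*x≈-x s) ⟩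
        - s + s                        ≈⟨ -‿inverseˡ s ⟩
        0#                             ∎

      ⊥u-punchIn : ∀ i → - (w * s) * u (punchIn p i) zero + l ∙ tail (u (punchIn p i)) ≈ 0#
      ⊥u-punchIn i = begin
        - (w * s) * u (punchIn p i) zero + l ∙ tail (u (punchIn p i))   ≈⟨ +-congʳ (negate-swap _) ⟩
        multiplier i * s + l ∙ tail (u (punchIn p i))
          ≈⟨ sum-linear k (multiplier i) _ _ _ (λ t →
               linear-scale (l t) (multiplier i) (u p (suc t)) (u (punchIn p i) (suc t))) ⟨
        l ∙ reduced i                                                   ≈⟨ l⊥ i ⟩
        0#                                                              ∎

      ⊥u : ∀ i → ((- (w * s)) ∷ l) ∙ u i ≈ 0#
      ⊥u i with p ≟ i
      ... | yes ≡.refl = ⊥uₚ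
      ... | no  p≢i    = ≡.subst (λ q → ((- (w * s)) ∷ l) ∙ u q ≈ 0#)
                           (punchIn-punchOut p≢i) (⊥u-punchIn (punchOut p≢i))

  special-agreeing : ∀ {k} {A : Matrix k} → 3 ≤ k → A ∈ GL k → ∀ u v →
                     ∃[ B ] B ∈ SL k × B *ⱽ u ≈ⱽ A *ⱽ u × B *ⱽ v ≈ⱽ A *ⱽ v
  special-agreeing {k} {A} 2<k A∈GL@(A⁻¹ , A⁻¹A≈1 , AA⁻¹≈1) u v =
    -- `2 < k` unfolds to `3 ≤ k`: two vectors always leave room for a common normal.
    agreeing (common-normal 2<k (u ∷ v ∷ []))
    where
    a b : Carrier
    -- `D a` has determinant `det A⁻¹`, and `b` is the parameter of the inverse dilation, which puts
    -- `D a` in `GL k`.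
    a = det A⁻¹ - 1#
    b = det A - 1#

    1+[x-1]≈x : ∀ x → 1# + (x - 1#) ≈ x
    1+[x-1]≈x x = begin
      1# + (x - 1#)    ≈⟨ solve 3 (λ o x m → o :+ (x :+ m) := x :+ (o :+ m)) refl 1# x (- 1#) ⟩
      x + (1# - 1#)    ≈⟨ +-congˡ (-‿inverseʳ 1#) ⟩
      x + 0#           ≈⟨ +-identityʳ x ⟩
      x                ∎

    det-inverse : ∀ {P Q : Matrix k} → P *ᴹ Q ≈ᴹ 1ᴹ → det P * det Q ≈ 1#
    det-inverse {P} {Q} PQ≈1 = trans (sym (det-* P Q)) (trans (det-cong PQ≈1) (det-1ᴹ {k}))

    agreeing : ∃[ l ] ∃[ j ] l j ≈ 1# × (∀ i → l ∙ (u ∷ v ∷ []) i ≈ 0#) →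
               ∃[ B ] B ∈ SL k × B *ⱽ u ≈ⱽ A *ⱽ u × B *ⱽ v ≈ⱽ A *ⱽ v
    agreeing (l , j , lⱼ≈1 , l⊥) =
      A *ᴹ D a ,
      (*-GL {A = A} {B = D a} A∈GL (D b , D-inverse AA⁻¹≈1 , D-inverse A⁻¹A≈1) , det≈1) ,
      agree u (l⊥ zero) , agree v (l⊥ (suc zero))
      where
      D = dilation l j

      D-inverse : ∀ {P Q : Matrix k} → P *ᴹ Q ≈ᴹ 1ᴹ →
                  D (det P - 1#) *ᴹ D (det Q - 1#) ≈ᴹ 1ᴹ
      D-inverse PQ≈1 = dilation-inverse l j lⱼ≈1 _ _
        (trans (*-cong (1+[x-1]≈x _) (1+[x-1]≈x _)) (det-inverse PQ≈1))

      det≈1 : det (A *ᴹ D a) ≈ 1#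
      det≈1 = begin
        det (A *ᴹ D a)        ≈⟨ det-* A (D a) ⟩
        det A * det (D a)     ≈⟨ *-congˡ (trans (det-dilation l j lⱼ≈1 a) (1+[x-1]≈x _)) ⟩
        det A * det A⁻¹       ≈⟨ det-inverse AA⁻¹≈1 ⟩
        1#                    ∎

      agree : ∀ x → l ∙ x ≈ 0# → (A *ᴹ D a) *ⱽ x ≈ⱽ A *ⱽ x
      agree x l∙x≈0 i = trans (*ⱽ-assoc A (D a) x i) (*ⱽ-congʳ A (dilation-fixes l j a x l∙x≈0) i)

  -- Affine maps

  -- From f(w) - f(x) = A(φ(w) - φ(x)), it is enough that `B` matches `A` on two differences taken
  -- after `φ`. The new map keeps this `φ`, so `φ ∈ H` carries over.
  ASL-agreeing : ∀ {h k} {H : Pred (Carrier → Carrier) h} → 3 ≤ k → ∀ {f} → f ∈ AGL k H → ∀ x y z →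
                 ∃[ g ] g ∈ ASL k H × g x ≈ⱽ f x × g y ≈ⱽ f y × g z ≈ⱽ f z
  ASL-agreeing {k = k} 3≤k {f} (A , φ , b , A∈GL , φ∈H , f≈) x y z =
    agreeing (special-agreeing 3≤k A∈GL (displacement y) (displacement z))
    where
    displacement : V k → V k
    displacement w i = φ (w i) - φ (x i)

    agreeing : ∃[ B ] B ∈ SL k × B *ⱽ displacement y ≈ⱽ A *ⱽ displacement y
                               × B *ⱽ displacement z ≈ⱽ A *ⱽ displacement z →
               ∃[ g ] g ∈ ASL k _ × g x ≈ⱽ f x × g y ≈ⱽ f y × g z ≈ⱽ f z
    agreeing (B , B∈SL , By≈Ay , Bz≈Az) =
      g , (B , φ , b′ , B∈SL , φ∈H , λ _ _ → refl) , agree-x , agree y By≈Ay , agree z Bz≈Az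
      where
      b′ : V k
      -- Forced by the requirement that `g` and `f` agree at `x`.
      b′ i = ((A *ⱽ (φ ∘ x)) i - (B *ⱽ (φ ∘ x)) i) + b i

      g : V k → V k
      g w = B *ⱽ (φ ∘ w) +ⱽ b′

      agree : ∀ w → B *ⱽ displacement w ≈ⱽ A *ⱽ displacement w → g w ≈ⱽ f w
      agree w Bw≈Aw i = begin
        Bw + ((Ax - Bx) + b i)
          ≈⟨ solve 4 (λ Bw Ax -Bx b → Bw :+ ((Ax :+ -Bx) :+ b) := (Bw :+ -Bx) :+ (Ax :+ b)) refl
               Bw Ax (- Bx) (b i) ⟩
        (Bw - Bx) + (Ax + b i)
          ≈⟨ +-congʳ (trans (sym (*ⱽ-- B (φ ∘ w) (φ ∘ x) i)) (trans (Bw≈Aw i) (*ⱽ-- A (φ ∘ w) (φ ∘ x) i))) ⟩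
        (Aw - Ax) + (Ax + b i)
          ≈⟨ solve 4 (λ Aw -Ax Ax b → (Aw :+ -Ax) :+ (Ax :+ b) := (Aw :+ b) :+ (Ax :+ -Ax)) refl
               Aw (- Ax) Ax (b i) ⟩
        (Aw + b i) + (Ax - Ax)    ≈⟨ trans (+-congˡ (-‿inverseʳ Ax)) (+-identityʳ _) ⟩
        Aw + b i                  ≈⟨ f≈ w i ⟨
        f w i                     ∎
        where
        Aw = (A *ⱽ (φ ∘ w)) i
        Ax = (A *ⱽ (φ ∘ x)) i
        Bw = (B *ⱽ (φ ∘ w)) i
        Bx = (B *ⱽ (φ ∘ x)) i

      agree-x : g x ≈ⱽ f x
      agree-x = agree x (λ i → trans (*ⱽ-displacement-x B i) (sym (*ⱽ-displacement-x A i)))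
        where
        *ⱽ-displacement-x : ∀ C i → (C *ⱽ displacement x) i ≈ 0#
        *ⱽ-displacement-x C i = trans (*ⱽ-- C (φ ∘ x) (φ ∘ x) i) (-‿inverseʳ _)

  module _ (k : ℕ) where
    open Triples (V-setoid k)

    -- One inclusion is `SL k` inside `GL k`. For the other, `g` may depend on the triple as well as
    -- on `f`, since membership in an orbit concerns three values only.
    orbit-ASL≐orbit-AGL : ∀ {h} {H : Pred (Carrier → Carrier) h} → 3 ≤ k →
                          ∀ t → orbit (ASL k H) t ≐ orbit (AGL k H) t
    orbit-ASL≐orbit-AGL 3≤k (x , y , z) =
      (λ (f , (A , φ , b , (A∈GL , _) , φ∈H , f≈) , ft≈) → f , (A , φ , b , A∈GL , φ∈H , f≈) , ft≈) ,
      λ (f , f∈AGL , fx≈ , fy≈ , fz≈) → case ASL-agreeing 3≤k f∈AGL x y z of λ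
        (g , g∈ASL , gx≈ , gy≈ , gz≈) →
          g , g∈ASL , ≋.trans gx≈ fx≈ , ≋.trans gy≈ fy≈ , ≋.trans gz≈ fz≈
      where module ≋ = Setoid (V-setoid k)

theorem3p5 : ∀ {c ℓ c′ ℓ′ : Level}
    (k p α ω : ℕ) → 3 ≤ k → Prime p → ω ∣ α →
    (F : FiniteField c ℓ (p ^ α)) (K : FiniteField c′ ℓ′ (p ^ ω))
    (ι : FiniteField.Carrier K → FiniteField.Carrier F) →
    IsEmbedding F K ι →
    let open Matrices F
        open Triples (V-setoid k)
        H = Gal F K ι
    in AST (ASL k H) ≐ AST (AGL k H)
theorem3p5 k p α ω 3≤k _ _ F K ι _ =
  -- The same triple `t` represents the class for both groups.
  (λ (t , R≐) → t , ≐-trans R≐ (orbit-ASL≐orbit-AGL k 3≤k t)) ,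
  (λ (t , R≐) → t , ≐-trans R≐ (≐-sym (orbit-ASL≐orbit-AGL k 3≤k t)))
  where open LinearAlgebra F
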